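{- The formulas $\mathrm{PebHint}(P_h)\circ\mathrm{OR}$, where $P_h$ is the pyramid graph of height $h$ with $n=\Theta(h^2)$ vertices, have MaxRes refutations of size $\Theta(n)$.
   Context: Pyramid graph $P_h$: the directed acyclic graph with layers $0,1,\dots,h$, where layer $i$ has vertices $(i,0),\dots,(i,h-i)$, and edges from $(i,j)$ and $(i,j+1)$ to $(i+1,j)$. The sources are the vertices of layer $0$ and the unique sink is $(h,0)$. The predecessors of a vertex are the origins of its incoming edges. Two vertices $u,v$ are siblings if they are incomparable (neither is reachable from the other) and have a common predecessor. For a DAG $G$ with single sink $z$ in which each non-source vertex has two predecessors, $\mathrm{PebHint}(G)\circ\mathrm{OR}$ has variables $v_1,v_2$ for each vertex $v$ and the following clauses: $v_1\vee v_2$ for each source $v$; for each internal vertex $w$ with predecessors $u,v$, the four clauses $\overline{u_a}\vee\overline{v_b}\vee w_1\vee w_2$ with $a,b\in\{1,2\}$; the clauses $\overline{z_1}$ and $\overline{z_2}$; and $u_1\vee u_2\vee v_1\vee v_2$ for each pair of siblings $(u,v)$. MaxSAT resolution rule: from $x\vee A$ and $\overline{x}\vee B$ with $A=a_1\vee\dots\vee a_s$, $B=b_1\vee\dots\vee b_t$, derive $A\vee B$; the clauses $x\vee A\vee b_1\vee\dots\vee b_{j-1}\vee\overline{b_j}$ for $1\le j\le t$; and the clauses $\overline{x}\vee B\vee a_1\vee\dots\vee a_{j-1}\vee\overline{a_j}$ for $1\le j\le s$. When the rule is applied to a multi-set of clauses, (one copy of) each antecedent is removed and all non-tautologous consequents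 are added. A MaxRes refutation of $F$ is a sequence of multi-sets $F=F_0,\dots,F_s$, each obtained from the previous one by one application of the MaxSAT resolution rule, with $F_s$ containing the empty clause; its size is $s$. -}

module Defs where

open import Level using (0ℓ)
open import Data.Nat.Base using (ℕ; zero; suc; _+_; _*_; _∸_; _≤_; _<_; s≤s)
open import Data.Nat.Properties as ℕ using ()
open import Data.Nat.Induction using (<-wellFounded)
open import Data.Fin.Base using (Fin; toℕ; fromℕ<)
open import Data.Fin.Patterns using (0F; 1F)
open import Data.Fin.Properties as Fin using (toℕ-fromℕ<; toℕ≤pred[n])
open import Data.List.Base
  using (List; []; _∷_; [_]; _++_; map; concatMap; filter; take; lookup;
         length; allFin; tabulate)
open import Data.List.Membership.Propositional using (_∈_)
open import Data.List.Membership.Propositional.Properties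
  using (∈-allFin; ∈-map⁺; ∈-map⁻; ∈-concat⁺′)
import Data.List.Relation.Unary.All.Properties as All
open import Data.List.Relation.Unary.Any using (Any; any?; satisfied)
open import Data.List.Membership.Propositional using (lose)
import Data.List.Relation.Unary.AllPairs.Properties as AllPairs
open import Data.List.Relation.Unary.Unique.Propositional using (Unique)
import Data.List.Relation.Unary.Unique.Propositional.Properties as Unique
open import Data.List.Relation.Binary.BagAndSetEquality using ([_]-Equality; set)
import Data.List.Relation.Binary.Permutation.Setoid as Permutation
import Data.List.Membership.DecPropositional as DecMembership
open import Data.Maybe.Base using (Maybe; just; nothing)
import Data.Maybe.Relation.Unary.Any as Maybe
import Data.Maybe.Relation.Unary.All as MaybeAll
open import Data.Product.Base using (∃-syntax; _×_; _,_; proj₁; proj₂)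
open import Data.Product.Properties using (≡-dec)
open import Data.Sum.Base using (_⊎_; inj₁; inj₂)
open import Data.Empty using (⊥-elim)
open import Function.Base using (_∘_)
open import Induction.WellFounded using (WellFounded; Acc; acc; module Subrelation)
import Relation.Binary.Construct.On as On
open import Relation.Binary.Construct.Closure.ReflexiveTransitive using (Star; ε; _◅_; _◅◅_)
open import Relation.Binary.Core using (Rel)
open import Relation.Binary.Definitions using (Decidable; DecidableEquality)
open import Relation.Binary.PropositionalEquality
  using (_≡_; _≢_; refl; sym; trans; cong; subst)
open import Relation.Nullary using (¬_; Dec; yes; no; ¬?; _×-dec_; _⊎-dec_; recompute)
open import Relation.Nullary.Decidable using (map′)

-- The lower constant is written as 1/c.  If c or C is 0 then both functions
-- vanish eventually, so no positivity condition is needed.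
infix 4 _∈Θ_

_∈Θ_ : (ℕ → ℕ) → (ℕ → ℕ) → Set
f ∈Θ g = ∃[ c ] ∃[ C ] ∃[ N ] (∀ h → N ≤ h → g h ≤ c * f h × f h ≤ C * g h)

data Literal (X : Set) : Set where
  pos neg : X → Literal X

negate : ∀ {X} → Literal X → Literal X
negate (pos x) = neg x
negate (neg x) = pos x

literal-≟ : ∀ {X} → DecidableEquality X → DecidableEquality (Literal X)
literal-≟ _≟_ (pos x) (pos y) = map′ (cong pos) (λ { refl → refl }) (x ≟ y)
literal-≟ _≟_ (pos x) (neg y) = no λ ()
literal-≟ _≟_ (neg x) (pos y) = no λ ()
literal-≟ _≟_ (neg x) (neg y) = map′ (cong neg) (λ { refl → refl }) (x ≟ y)

module MaxRes {X : Set} (_≟_ : DecidableEquality X) where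

  open DecMembership (literal-≟ _≟_) using (_∈?_)

  Clause : Set
  Clause = List (Literal X)

  ClauseMultiset : Set
  ClauseMultiset = List Clause

  -- Clauses are compared as sets of literals, and lists of clauses as
  -- multisets of such sets.
  open Permutation ([ set ]-Equality (Literal X)) using (_↭_)

  Tautologous : Clause → Set
  Tautologous C = Any (λ l → negate l ∈ C) C

  tautologous? : ∀ C → Dec (Tautologous C)
  tautologous? C = any? (λ l → negate l ∈? C) C

  -- The clauses P ∨ b₁ ∨ ⋯ ∨ bⱼ₋₁ ∨ ¬bⱼ for 1 ≤ j ≤ t.
  compensation : Clause → Clause → ClauseMultiset
  compensation P B = tabulate λ j → P ++ take (toℕ j) B ++ [ negate (lookup B j) ]

  consequents : X → Clause → Clause → ClauseMultiset
  consequents x A B =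
    (A ++ B) ∷ compensation (pos x ∷ A) B ++ compensation (neg x ∷ B) A

  -- The outcome depends on the order in which A and B are listed; a step may
  -- use any repetition-free listing of its two antecedents.
  data _⟶_ (F G : ClauseMultiset) : Set where
    resolve : ∀ x A B R →
              Unique (pos x ∷ A) → Unique (neg x ∷ B) →
              F ↭ (pos x ∷ A) ∷ (neg x ∷ B) ∷ R →
              G ↭ filter (¬? ∘ tautologous?) (consequents x A B) ++ R →
              F ⟶ G

  data _⟶[_]_ (F : ClauseMultiset) : ℕ → ClauseMultiset → Set where
    done : F ⟶[ 0 ] F
    step : ∀ {s G H} → F ⟶ G → G ⟶[ s ] H → F ⟶[ suc s ] H

  Refutation : ClauseMultiset → ℕ → Set
  Refutation F s = ∃[ G ] F ⟶[ s ] G × [] ∈ G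

unorderedPairs : ∀ {A : Set} → List A → List (A × A)
unorderedPairs []       = []
unorderedPairs (x ∷ xs) = map (x ,_) xs ++ unorderedPairs xs

module Edges {V : Set} (predecessors : V → Maybe (V × V)) where

  infix 4 _⇒_ _⇒*_

  _⇒_ : Rel V 0ℓ
  u ⇒ w = Maybe.Any (λ (p , q) → u ≡ p ⊎ u ≡ q) (predecessors w)

  _⇒*_ : Rel V 0ℓ
  _⇒*_ = Star _⇒_

record PebblingDAG : Set₁ where
  field
    Vertex       : Set
    _≟_          : DecidableEquality Vertex
    vertices     : List Vertex
    unique       : Unique vertices
    complete     : ∀ v → v ∈ vertices
    -- Sources are mapped to nothing.
    predecessors : Vertex → Maybe (Vertex × Vertex)

  open Edges predecessors public

  field
    distinct     : ∀ w → MaybeAll.All (λ (p , q) → p ≢ q) (predecessors w)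
    -- Since there are finitely many vertices, this says there is no cycle.
    acyclic      : WellFounded _⇒_
    sink         : Vertex
    sink-out     : ∀ w → ¬ sink ⇒ w
    sink-unique  : ∀ v → (∀ w → ¬ v ⇒ w) → v ≡ sink

  _⇒?_ : Decidable _⇒_
  u ⇒? w = Maybe.dec (λ (p , q) → (u ≟ p) ⊎-dec (u ≟ q)) (predecessors w)

  lastStep : ∀ {u w} → u ⇒* w → u ≡ w ⊎ ∃[ p ] u ⇒* p × p ⇒ w
  lastStep ε = inj₁ refl
  lastStep (e ◅ es) with lastStep es
  ... | inj₁ refl            = inj₂ (_ , ε , e)
  ... | inj₂ (p , es′ , e′) = inj₂ (p , e ◅ es′ , e′)

  reach? : ∀ u w → Acc _⇒_ w → Dec (u ⇒* w)
  reach? u w (acc rs) = map′ to from ((u ≟ w) ⊎-dec any? via? vertices)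
    where
    via? : ∀ p → Dec (u ⇒* p × p ⇒ w)
    via? p with p ⇒? w
    ... | no ¬e = no (¬e ∘ proj₂)
    ... | yes e = map′ (_, e) proj₁ (reach? u p (rs e))

    to : u ≡ w ⊎ Any (λ p → u ⇒* p × p ⇒ w) vertices → u ⇒* w
    to (inj₁ refl) = ε
    to (inj₂ via) with _ , r , e ← satisfied via = r ◅◅ e ◅ ε

    from : u ⇒* w → u ≡ w ⊎ Any (λ p → u ⇒* p × p ⇒ w) vertices
    from r with lastStep r
    ... | inj₁ u≡w      = inj₁ u≡w
    ... | inj₂ (p , es) = inj₂ (lose (complete p) es)

  _⇒*?_ : Decidable _⇒*_
  u ⇒*? w = reach? u w (acyclic w)

  CommonPredecessor : Rel Vertex 0ℓ
  CommonPredecessor u v = ∃[ p ] p ⇒ u × p ⇒ v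

  Siblings : Rel Vertex 0ℓ
  Siblings u v = (¬ u ⇒* v × ¬ v ⇒* u) × CommonPredecessor u v

  siblings? : Decidable Siblings
  siblings? u v = (¬? (u ⇒*? v) ×-dec ¬? (v ⇒*? u)) ×-dec
    map′ satisfied (λ (p , es) → lose (complete p) es)
      (any? (λ p → (p ⇒? u) ×-dec (p ⇒? v)) vertices)

  size : ℕ
  size = length vertices

-- PebHint(G) ∘ OR; the variables v₁ and v₂ are (v , 0F) and (v , 1F).
module _ (G : PebblingDAG) where

  open PebblingDAG G

  Variable : Set
  Variable = Vertex × Fin 2

  variable-≟ : DecidableEquality Variable
  variable-≟ = ≡-dec _≟_ Fin._≟_

  open MaxRes variable-≟ using (Clause; ClauseMultiset)

  or : Vertex → Clause
  or v = pos (v , 0F) ∷ pos (v , 1F) ∷ []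

  pebbling : Vertex → ClauseMultiset
  pebbling w with predecessors w
  ... | nothing      = [ or w ]
  ... | just (u , v) =
    concatMap (λ a → map (λ b → neg (u , a) ∷ neg (v , b) ∷ or w) (allFin 2)) (allFin 2)

  PebHint∘OR : ClauseMultiset
  PebHint∘OR =
    concatMap pebbling vertices ++
    map (λ a → [ neg (sink , a) ]) (allFin 2) ++
    map (λ (u , v) → or u ++ or v)
      (filter (λ (u , v) → siblings? u v) (unorderedPairs vertices))

MaxResRefutation : (G : PebblingDAG) → ℕ → Set
MaxResRefutation G = MaxRes.Refutation (variable-≟ G) (PebHint∘OR G)

-- Layer i has the positions 0, …, h - i.
record PyramidVertex (h : ℕ) : Set where
  constructor ⟨_,_⟩
  field
    layer     : ℕ
    position  : ℕ
    .{inRange} : layer + position ≤ h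

module _ (h : ℕ) where

  open PyramidVertex

  V : Set
  V = PyramidVertex h

  _≟ᵥ_ : DecidableEquality V
  ⟨ i , j ⟩ ≟ᵥ ⟨ i′ , j′ ⟩ =
    map′ (λ { (refl , refl) → refl }) (λ { refl → refl , refl })
      ((i ℕ.≟ i′) ×-dec (j ℕ.≟ j′))

  pyramidPredecessors : V → Maybe (V × V)
  pyramidPredecessors (⟨ zero  , j ⟩)     = nothing
  pyramidPredecessors (⟨ suc i , j ⟩ {r}) =
    just (⟨ i , j ⟩ {ℕ.<⇒≤ r} , ⟨ i , suc j ⟩ {subst (_≤ h) (sym (ℕ.+-suc i j)) r})

  vertex : (i : Fin (suc h)) → Fin (suc (h ∸ toℕ i)) → V
  vertex i j = ⟨ toℕ i , toℕ j ⟩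
    {ℕ.≤-trans (ℕ.+-monoʳ-≤ (toℕ i) (toℕ≤pred[n] j)) (ℕ.≤-reflexive (ℕ.m+[n∸m]≡n (toℕ≤pred[n] i)))}

  layerVertices : Fin (suc h) → List V
  layerVertices i = map (vertex i) (allFin (suc (h ∸ toℕ i)))

  pyramidVertices : List V
  pyramidVertices = concatMap layerVertices (allFin (suc h))

  open Edges pyramidPredecessors

  pyramidUnique : Unique pyramidVertices
  pyramidUnique = Unique.concat⁺
    (All.map⁺ {f = layerVertices} (All.tabulate⁺ {f = λ i → i} λ i →
      Unique.map⁺ {f = vertex i} (λ eq → Fin.toℕ-injective (cong position eq)) (Unique.allFin⁺ _)))
    (AllPairs.map⁺ {f = layerVertices} (AllPairs.tabulate⁺ {f = λ i → i} disjoint))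
    where
    layer≡ : ∀ i {v} → v ∈ layerVertices i → layer v ≡ toℕ i
    layer≡ i v∈ with _ , _ , refl ← ∈-map⁻ (vertex i) v∈ = refl

    disjoint : ∀ {i k} → i ≢ k → ∀ {v} → ¬ (v ∈ layerVertices i × v ∈ layerVertices k)
    disjoint {i} {k} i≢k (v∈i , v∈k) =
      i≢k (Fin.toℕ-injective (trans (sym (layer≡ i v∈i)) (layer≡ k v∈k)))

  ext : ∀ {x y : V} → layer x ≡ layer y → position x ≡ position y → x ≡ y
  ext refl refl = refl

  range : (v : V) → layer v + position v ≤ h
  range (⟨ i , j ⟩ {r}) = recompute (i + j ℕ.≤? h) r

  pyramidComplete : ∀ v → v ∈ pyramidVertices
  pyramidComplete v = ∈-concat⁺′ (subst (_∈ layerVertices i) v≡ (∈-map⁺ (vertex i) (∈-allFin j)))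
                                 (∈-map⁺ layerVertices (∈-allFin i))
    where
    i<   = s≤s (ℕ.m+n≤o⇒m≤o (layer v) (range v))
    i    = fromℕ< i<
    i≡   = toℕ-fromℕ< i<
    j≤   : position v ≤ h ∸ toℕ i
    j≤   = subst (λ k → position v ≤ h ∸ k) (sym i≡)
             (ℕ.m+n≤o⇒m≤o∸n (position v)
               (subst (_≤ h) (ℕ.+-comm (layer v) (position v)) (range v)))
    j    = fromℕ< (s≤s j≤)
    v≡   : vertex i j ≡ v
    v≡   = ext i≡ (toℕ-fromℕ< (s≤s j≤))

  pyramidDistinct : ∀ w → MaybeAll.All (λ (p , q) → p ≢ q) (pyramidPredecessors w)
  pyramidDistinct (⟨ zero  , j ⟩) = MaybeAll.nothing
  pyramidDistinct (⟨ suc i , j ⟩) = MaybeAll.just λ eq → ℕ.1+n≢n (sym (cong position eq))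

  edgeLayer : ∀ {u w} → u ⇒ w → layer u < layer w
  edgeLayer {w = ⟨ suc i , j ⟩} (Maybe.just (inj₁ refl)) = ℕ.n<1+n i
  edgeLayer {w = ⟨ suc i , j ⟩} (Maybe.just (inj₂ refl)) = ℕ.n<1+n i

  pyramidAcyclic : WellFounded _⇒_
  pyramidAcyclic = Subrelation.wellFounded edgeLayer (On.wellFounded layer <-wellFounded)

  top : V
  top = ⟨ h , 0 ⟩ {ℕ.≤-reflexive (ℕ.+-identityʳ h)}

  topOut : ∀ w → ¬ top ⇒ w
  topOut w e = ℕ.<⇒≱ (edgeLayer e) (ℕ.m+n≤o⇒m≤o (layer w) (range w))

  topUnique : ∀ v → (∀ w → ¬ v ⇒ w) → v ≡ top
  topUnique v@(⟨ i , suc j ⟩) noOut = ⊥-elim (noOut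
    (⟨ suc i , j ⟩ {subst (_≤ h) (ℕ.+-suc i j) (range v)}) (Maybe.just (inj₂ refl)))
  topUnique v@(⟨ i , zero ⟩) noOut with suc i + 0 ℕ.≤? h
  ... | yes r = ⊥-elim (noOut (⟨ suc i , zero ⟩ {r}) (Maybe.just (inj₁ refl)))
  ... | no ¬r = ext (ℕ.≤-antisym
          (subst (_≤ h) (ℕ.+-identityʳ i) (range v))
          (subst (h ≤_) (ℕ.+-identityʳ i) (ℕ.≮⇒≥ ¬r))) refl

  Pyramid : PebblingDAG
  Pyramid = record
    { Vertex       = V
    ; _≟_          = _≟ᵥ_
    ; vertices     = pyramidVertices
    ; unique       = pyramidUnique
    ; complete     = pyramidComplete
    ; predecessors = pyramidPredecessors
    ; distinct     = pyramidDistinct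
    ; acyclic      = pyramidAcyclic
    ; sink         = top
    ; sink-out     = topOut
    ; sink-unique  = topUnique
    }

{-# OPTIONS --safe #-}

-- Derive or x for all vertices x, row by row and in each row from left to
-- right, with a bounded number of steps per vertex.  Each clause is consumed
-- when it is used, but or t is needed for both successors x and y of t.  The
-- derivation of or x from its predecessors v and t leaves, among its
-- compensation clauses, an encoding of t ∨ ¬x; resolving it with the hint
-- x ∨ y yields y ∨ t, and the derivation of or y works with y ∨ t in place of t.

module Submission where

open import Defs
import Algebra.Solver.CommutativeMonoid as CommutativeMonoidSolver
open import Data.Nat using (ℕ; _^_; zero; suc; _+_; _*_; _∸_; _≤_; _<_; z≤n; s≤s)
import Data.Nat.Properties as ℕ
open import Data.Nat.Tactic.RingSolver using (solve-∀)
open import Data.Product using (∃-syntax; _×_; ∃₂; _,_; proj₁; proj₂)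
open import Data.Product.Properties using (≡-dec; ,-injective)
open import Data.Sum.Base using (_⊎_; inj₁; inj₂)
open import Data.Bool.Base using (Bool; true; false; if_then_else_)
open import Data.Fin.Base using (Fin; suc; toℕ)
open import Data.Fin.Patterns
import Data.Fin.Properties as Fin
open import Data.List.Base
  using (List; []; _∷_; [_]; _++_; map; concat; concatMap; filter; take; lookup;
         length; allFin; tabulate)
open import Data.List.Properties as List using (map-++)
open import Data.List.Membership.Propositional using (_∈_)
open import Data.List.Membership.Propositional.Properties using (∈-map⁺; ∈-map⁻)
open import Data.List.Relation.Unary.All using (All; []; _∷_)
import Data.List.Relation.Unary.All.Properties as All
open import Data.List.Relation.Unary.Any as Any using (Any; here)
import Data.List.Relation.Unary.Any.Properties as Any
open import Data.List.Relation.Unary.Unique.Propositional using (Unique)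
import Data.List.Relation.Unary.Unique.Propositional.Properties as Unique
import Data.List.Relation.Unary.Unique.DecPropositional as DecUnique
import Data.List.Relation.Binary.Subset.DecPropositional as DecSubset
open import Data.List.Relation.Binary.BagAndSetEquality using ([_]-Equality; _∼[_]_; set; map-cong)
import Data.List.Relation.Binary.Permutation.Setoid as Permutation
import Data.List.Relation.Binary.Permutation.Setoid.Properties as PermutationProperties
open import Data.List.Relation.Binary.Sublist.Propositional
  using (_⊆_; []; _∷_; _∷ʳ_; ⊆-refl; ⊆-reflexive; ⊆-trans)
import Data.List.Relation.Binary.Sublist.Propositional.Properties as Sublist
open import Data.Maybe using (Maybe; just; nothing; _>>=_; to-witness-T)
open import Data.Maybe.Relation.Unary.Any using (just)
open import Data.Vec.Base as Vec using (Vec; []; _∷_)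
open import Data.Vec.Relation.Unary.All using ([]; _∷_)
open import Data.Vec.Relation.Unary.AllPairs using ([]; _∷_)
import Data.Vec.Relation.Unary.Unique.Propositional as VecUnique
import Data.Vec.Relation.Unary.Unique.Propositional.Properties as VecUnique
open import Function.Base using (_∘_; id)
open import Function.Bundles using (mk⇔; Equivalence)
open import Function.Definitions using (Injective)
open import Function.Related.Propositional using (K-refl)
open import Relation.Binary.Construct.Closure.ReflexiveTransitive using (ε; _◅_)
open import Relation.Binary.Definitions using (DecidableEquality)
open import Relation.Binary.PropositionalEquality using (_≡_; _≢_; refl; sym; trans; cong; cong₂; subst)
open import Relation.Nullary using (¬_; Dec; yes; no; ¬?; contradiction)

-- MaxRes derivations with leftovers, and a checker for concrete ones

module Derivations {X : Set} (_≟_ : DecidableEquality X) where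

  open MaxRes _≟_ public
  open Permutation ([ set ]-Equality (Literal X)) public
    using (_↭_; ↭-refl; ↭-sym; ↭-trans; ↭-prep; ↭-reflexive)
  open PermutationProperties ([ set ]-Equality (Literal X)) public
    using (++⁺; ++⁺ʳ; ++⁺ˡ; ++-assoc; ++-identityʳ; shifts; ∈-resp-↭; ++-commutativeMonoid)

  resolvents : X → Clause → Clause → ClauseMultiset
  resolvents x A B = filter (¬? ∘ tautologous?) (consequents x A B)

  -- Steps leave compensation clauses behind and no rule deletes a clause, so `Δ` can only be asked
  -- to be part of the last multiset; `L` is the rest.
  _⊢[_]_ : ClauseMultiset → ℕ → ClauseMultiset → Set
  Γ ⊢[ s ] Δ = ∃₂ λ G L → Γ ⟶[ s ] G × G ↭ Δ ++ L

  -- Unlike _⊢[_]_, it allows a context R of further clauses, which survive.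
  record _⟹[_]_ (Γ : ClauseMultiset) (s : ℕ) (Δ : ClauseMultiset) : Set where
    field
      run-in : ∀ {F R} → F ↭ Γ ++ R → ∃₂ λ G L → F ⟶[ s ] G × G ↭ Δ ++ (L ++ R)

  open _⟹[_]_ public

  open DecSubset (literal-≟ _≟_) using (_⊆?_)
  open DecUnique (literal-≟ _≟_) using (unique?)

  -- Two inclusion tests decide equality as sets of literals, so an inference may list its
  -- antecedents in whatever order yields the wanted compensation clauses.
  extractOne : ∀ C F → Maybe (∃[ L ] F ↭ C ∷ L)
  extractOne C []      = nothing
  extractOne C (D ∷ F) with D ⊆? C | C ⊆? D
  ... | yes D⊆C | yes C⊆D = just (F , Permutation.prep (mk⇔ D⊆C C⊆D) ↭-refl)
  ... | _       | _       = do
    L , F↭ ← extractOne C F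
    just (D ∷ L , ↭-trans (↭-prep D F↭) (shifts [ D ] [ C ]))

  extract : ∀ Δ F → Maybe (∃[ L ] F ↭ Δ ++ L)
  extract []      F = just (F , ↭-refl)
  extract (C ∷ Δ) F = do
    F′ , F↭  ← extractOne C F
    L  , F′↭ ← extract Δ F′
    just (L , ↭-trans F↭ (↭-prep C F′↭))

  Inference : Set
  Inference = X × Clause × Clause

  -- Replays the inferences and returns the derivation itself, so that a concrete derivation is
  -- established by evaluation.
  run : ∀ Γ (is : List Inference) Δ → Maybe (Γ ⊢[ length is ] Δ)
  run Γ []                Δ = do
    L , Γ↭ ← extract Δ Γ
    just (Γ , L , done , Γ↭)
  run Γ ((x , A , B) ∷ is) Δ with unique? (pos x ∷ A) | unique? (neg x ∷ B)
  ... | yes uA | yes uB = do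
    R , Γ↭         ← extract ((pos x ∷ A) ∷ (neg x ∷ B) ∷ []) Γ
    G , L , d , G↭ ← run (resolvents x A B ++ R) is Δ
    just (G , L , step (resolve x A B R uA uB Γ↭ ↭-refl) d , G↭)
  ... | _      | _      = nothing

  ⟹-refl : ∀ {Γ} → Γ ⟹[ 0 ] Γ
  ⟹-refl .run-in {F} F↭ = F , [] , done , F↭

  ⟶-append : ∀ {m n F G H} → F ⟶[ m ] G → G ⟶[ n ] H → F ⟶[ m + n ] H
  ⟶-append done        es = es
  ⟶-append (step d ds) es = step d (⟶-append ds es)

  -- The leftovers of `f` join the context in which `g` runs.
  ⟹-trans : ∀ {m n Γ Δ Θ} → Γ ⟹[ m ] Δ → Δ ⟹[ n ] Θ → Γ ⟹[ m + n ] Θ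
  ⟹-trans {Θ = Θ} f g .run-in {R = R} F↭
    with G , L , d , G↭ ← f .run-in F↭ with H , M , e , H↭ ← g .run-in G↭ =
    H , M ++ L , ⟶-append d e , ↭-trans H↭ (++⁺ˡ Θ (↭-sym (++-assoc M L R)))

  ⟹-frame : ∀ {n Γ Δ} Ξ → Γ ⟹[ n ] Δ → (Γ ++ Ξ) ⟹[ n ] (Δ ++ Ξ)
  ⟹-frame {Γ = Γ} {Δ} Ξ f .run-in {R = R} F↭
    with G , L , d , G↭ ← f .run-in (↭-trans F↭ (++-assoc Γ Ξ R)) =
    G , L , d , ↭-trans G↭ (↭-trans (++⁺ˡ Δ (shifts L Ξ)) (↭-sym (++-assoc Δ Ξ (L ++ R))))

  ⟹-keep : ∀ {n Γ Δ} C → Γ ⟹[ n ] Δ → (C ∷ Γ) ⟹[ n ] (C ∷ Δ)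
  ⟹-keep {Γ = Γ} {Δ} C f .run-in F↭
    with G , L , d , G↭ ← f .run-in (↭-trans F↭ (shifts [ C ] Γ)) =
    G , L , d , ↭-trans G↭ (↭-trans (++⁺ˡ Δ (shifts L [ C ])) (shifts Δ [ C ]))

  -- Surplus premises are passed to `f` as context and then counted among the leftovers.
  ⟹-weaken : ∀ {n Γ′ Γ Δ} Ξ → Γ′ ↭ Γ ++ Ξ → Γ ⟹[ n ] Δ → Γ′ ⟹[ n ] Δ
  ⟹-weaken {Γ = Γ} {Δ} Ξ Γ′↭ f .run-in {R = R} F↭
    with G , L , d , G↭ ← f .run-in (↭-trans F↭ (↭-trans (++⁺ʳ R Γ′↭) (++-assoc Γ Ξ R))) =
    G , L ++ Ξ , d , ↭-trans G↭ (++⁺ˡ Δ (↭-sym (++-assoc L Ξ R)))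

  ⟹-focus : ∀ {m n Γ′ Γ Δ Θ} Ξ → Γ′ ↭ Γ ++ Ξ → Γ ⟹[ m ] Δ → (Δ ++ Ξ) ⟹[ n ] Θ → Γ′ ⟹[ m + n ] Θ
  ⟹-focus {Γ = Γ} {Δ} Ξ Γ′↭ f g =
    -- Weakening by the empty multiset only rearranges the premises.
    ⟹-trans (⟹-weaken [] (↭-trans Γ′↭ (↭-sym (++-identityʳ (Γ ++ Ξ)))) (⟹-frame Ξ f)) g

  ⟹-refutation : ∀ {n Γ} → Γ ⟹[ n ] [ [] ] → Refutation Γ n
  ⟹-refutation {Γ = Γ} f with G , L , d , G↭ ← f .run-in (↭-sym (++-identityʳ Γ)) =
    G , d , Any.map empty (∈-resp-↭ (↭-sym G↭) (here K-refl))
    where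
    -- The permutation only provides a clause with the same set of literals as `[]`, whereas a
    -- refutation asks for `[]` itself.
    empty : ∀ {C : Clause} → [] ∼[ set ] C → [] ≡ C
    empty {[]}    _    = refl
    empty {l ∷ C} []∼C with () ← Equivalence.from []∼C (here refl)

  ⊆⇒↭ : ∀ {F G} → F ⊆ G → ∃[ L ] G ↭ F ++ L
  ⊆⇒↭ []                   = [] , ↭-refl
  ⊆⇒↭ {F} (C ∷ʳ τ)         with L , p ← ⊆⇒↭ τ = C ∷ L , ↭-trans (↭-prep C p) (shifts [ C ] F)
  ⊆⇒↭ (_∷_ {x = C} refl τ) with L , p ← ⊆⇒↭ τ = L , ↭-prep C p

-- Invariance of derivations under injective renaming of variables

renameLiteral : ∀ {X Y : Set} → (X → Y) → Literal X → Literal Y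
renameLiteral ρ (pos x) = pos (ρ x)
renameLiteral ρ (neg x) = neg (ρ x)

negate-rename : ∀ {X Y} (ρ : X → Y) l → negate (renameLiteral ρ l) ≡ renameLiteral ρ (negate l)
negate-rename ρ (pos x) = refl
negate-rename ρ (neg x) = refl

renameLiteral-injective : ∀ {X Y} {ρ : X → Y} → Injective _≡_ _≡_ ρ → Injective _≡_ _≡_ (renameLiteral ρ)
renameLiteral-injective inj {pos x} {pos y} eq = cong pos (inj (pos-injective eq))
  where
  pos-injective : ∀ {Y : Set} {x y : Y} → pos x ≡ pos y → x ≡ y
  pos-injective refl = refl
renameLiteral-injective inj {neg x} {neg y} eq = cong neg (inj (neg-injective eq))
  where
  neg-injective : ∀ {Y : Set} {x y : Y} → neg x ≡ neg y → x ≡ y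
  neg-injective refl = refl
renameLiteral-injective inj {pos x} {neg y} ()
renameLiteral-injective inj {neg x} {pos y} ()

module Renaming {X Y : Set} (_≟X_ : DecidableEquality X) (_≟Y_ : DecidableEquality Y)
                (ρ : X → Y) (ρ-injective : Injective _≡_ _≡_ ρ) where

  private
    module DX = Derivations _≟X_
    module DY = Derivations _≟Y_

  rename : DX.Clause → DY.Clause
  rename = map (renameLiteral ρ)

  -- A general `g` in place of `P ++_` lets the induction on `B` absorb each literal it passes into
  -- the prefix.
  tabulate-prefixes : (g : DX.Clause → DX.Clause) (g′ : DY.Clause → DY.Clause) →
    (∀ D → rename (g D) ≡ g′ (rename D)) → ∀ B →
    map rename (tabulate λ j → g (take (toℕ j) B ++ [ negate (lookup B j) ])) ≡
    tabulate λ j → g′ (take (toℕ j) (rename B) ++ [ negate (lookup (rename B) j) ])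
  tabulate-prefixes g g′ eq []      = refl
  tabulate-prefixes g g′ eq (b ∷ B) = cong₂ _∷_
    (trans (eq _) (cong (λ l → g′ [ l ]) (sym (negate-rename ρ b))))
    (tabulate-prefixes (g ∘ (b ∷_)) (g′ ∘ (renameLiteral ρ b ∷_)) (λ D → eq (b ∷ D)) B)

  compensation-rename : ∀ P B →
    map rename (DX.compensation P B) ≡ DY.compensation (rename P) (rename B)
  compensation-rename P = tabulate-prefixes (P ++_) (rename P ++_) (map-++ _ P)

  consequents-rename : ∀ x A B →
    map rename (DX.consequents x A B) ≡ DY.consequents (ρ x) (rename A) (rename B)
  consequents-rename x A B = cong₂ _∷_ (map-++ _ A B) (trans
    (map-++ rename (DX.compensation (pos x ∷ A) B) _)
    (cong₂ _++_ (compensation-rename (pos x ∷ A) B) (compensation-rename (neg x ∷ B) A)))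

  tautologous-rename⁺ : ∀ {C} → DX.Tautologous C → DY.Tautologous (rename C)
  tautologous-rename⁺ {C} = Any.map⁺ ∘ Any.map λ {l} ¬l∈C →
    subst (_∈ rename C) (sym (negate-rename ρ l)) (∈-map⁺ _ ¬l∈C)

  -- Injectivity matters here: identifying two variables could make literals complementary, and the
  -- rule would then drop a clause it should keep.
  tautologous-rename⁻ : ∀ {C} → DY.Tautologous (rename C) → DX.Tautologous C
  tautologous-rename⁻ {C} = Any.map reflect ∘ Any.map⁻
    where
    reflect : ∀ {l} → negate (renameLiteral ρ l) ∈ rename C → negate l ∈ C
    reflect {l} ¬l∈ with k , k∈C , eq ← ∈-map⁻ _ ¬l∈ =
      subst (_∈ C) (sym (renameLiteral-injective ρ-injective (trans (sym (negate-rename ρ l)) eq))) k∈C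

  filter-rename : ∀ Cs →
    map rename (filter (¬? ∘ DX.tautologous?) Cs) ≡ filter (¬? ∘ DY.tautologous?) (map rename Cs)
  filter-rename []       = refl
  filter-rename (C ∷ Cs) with DX.tautologous? C | DY.tautologous? (rename C)
  ... | yes _ | yes _ = filter-rename Cs
  ... | no  _ | no  _ = cong (rename C ∷_) (filter-rename Cs)
  ... | yes t | no ¬t = contradiction (tautologous-rename⁺ t) ¬t
  ... | no ¬t | yes t = contradiction (tautologous-rename⁻ t) ¬t

  resolvents-rename : ∀ x A B →
    map rename (DX.resolvents x A B) ≡ DY.resolvents (ρ x) (rename A) (rename B)
  resolvents-rename x A B = trans (filter-rename (DX.consequents x A B))
    (cong (filter (¬? ∘ DY.tautologous?)) (consequents-rename x A B))

  ↭-rename : ∀ {F G} → F DX.↭ G → map rename F DY.↭ map rename G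
  ↭-rename = PermutationProperties.map⁺ ([ set ]-Equality _) ([ set ]-Equality _)
    (map-cong λ _ → refl)

  -- A step touches only its two antecedents, so `R` can be added to the clauses it leaves alone.
  step-rename : ∀ {Γ G F R} → Γ DX.⟶ G → F DY.↭ map rename Γ ++ R → F DY.⟶ (map rename G ++ R)
  step-rename {R = R} (MaxRes.resolve x A B S uA uB Γ↭ G↭) F↭ =
    MaxRes.resolve (ρ x) (rename A) (rename B) (map rename S ++ R)
      (Unique.map⁺ (renameLiteral-injective ρ-injective) uA)
      (Unique.map⁺ (renameLiteral-injective ρ-injective) uB)
      (DY.↭-trans F↭ (DY.++⁺ʳ R (↭-rename Γ↭)))
      (DY.↭-trans (DY.++⁺ʳ R (DY.↭-trans (↭-rename G↭) (DY.↭-reflexive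
          (trans (map-++ rename (DX.resolvents x A B) S)
            (cong (_++ map rename S) (resolvents-rename x A B))))))
        (DY.++-assoc (DY.resolvents (ρ x) (rename A) (rename B)) _ R))

  steps-rename : ∀ {s Γ G F R} → Γ DX.⟶[ s ] G → F DY.↭ map rename Γ ++ R →
    ∃[ H ] F DY.⟶[ s ] H × H DY.↭ map rename G ++ R
  steps-rename MaxRes.done       F↭ = _ , MaxRes.done , F↭
  steps-rename (MaxRes.step d ds) F↭ with H , es , H↭ ← steps-rename ds DY.↭-refl =
    H , MaxRes.step (step-rename d F↭) es , H↭

  -- Carries a derivation evaluated over finitely many variables into any formula that contains a
  -- renamed copy of its premises.
  ⊢-rename : ∀ {s Γ Δ} → Γ DX.⊢[ s ] Δ → map rename Γ DY.⟹[ s ] map rename Δ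
  ⊢-rename {Δ = Δ} (G , L , d , G↭) .DY.run-in {R = R} F↭
    with H , e , H↭ ← steps-rename d F↭ =
    H , map rename L , e , DY.↭-trans H↭ (DY.↭-trans
      (DY.++⁺ʳ R (DY.↭-trans (↭-rename G↭) (DY.↭-reflexive (map-++ rename Δ L))))
      (DY.++-assoc (map rename Δ) _ R))

-- Concrete derivations for one cell and for the sink

-- The vertices 0F and 1F are the predecessors v and t of the vertex x = 2F; in
-- HintedCell, 3F is the other successor y of t.
module Cell (n : ℕ) where

  open Derivations (≡-dec (Fin._≟_ {3 + n}) (Fin._≟_ {2}))

  v₁ v₂ t₁ t₂ x₁ x₂ : Fin (3 + n) × Fin 2
  v₁ = 0F , 0F
  v₂ = 0F , 1F
  t₁ = 1F , 0F
  t₂ = 1F , 1F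
  x₁ = 2F , 0F
  x₂ = 2F , 1F

  ors : Fin (3 + n) → Clause
  ors v = pos (v , 0F) ∷ pos (v , 1F) ∷ []

  -- What is available for v. In the first cell of a row this is or v; in a later cell the preceding
  -- one has spent or v and left x ∨ v.
  carry : Bool → Clause
  carry false = ors 0F
  carry true  = ors 2F ++ ors 0F

  premises : Bool → ClauseMultiset
  premises b = carry b ∷ ors 1F ∷
    concatMap (λ a → map (λ c → neg (0F , a) ∷ neg (1F , c) ∷ ors 2F) (allFin 2)) (allFin 2)

  -- The first two inferences give ¬v₁ ∨ x and use up or t.  The fourth and
  -- fifth turn their compensation clauses t ∨ v₁, t ∨ ¬v₁ ∨ ¬x₁ and
  -- t ∨ ¬v₁ ∨ x₁ ∨ ¬x₂ into t ∨ v₁ ∨ x, which replaces t in the proof of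
  -- ¬v₂ ∨ x, and into the clauses t ∨ ¬x₁ and t ∨ x₁ ∨ ¬x₂ needed for the hint.
  inferences : Bool → List Inference
  inferences b =
    (t₁ , pos t₂ ∷ [] , neg v₁ ∷ ors 2F) ∷
    (t₂ , neg v₁ ∷ ors 2F , neg v₁ ∷ ors 2F) ∷
    (v₁ , pos v₂ ∷ (if b then ors 2F else []) , ors 2F) ∷
    (v₁ , ors 1F , pos t₁ ∷ pos t₂ ∷ neg x₁ ∷ []) ∷
    (v₁ , pos t₁ ∷ pos t₂ ∷ pos x₁ ∷ [] , pos t₁ ∷ pos t₂ ∷ pos x₁ ∷ neg x₂ ∷ []) ∷
    (t₁ , pos v₁ ∷ pos t₂ ∷ ors 2F , neg v₂ ∷ ors 2F) ∷
    (t₂ , pos v₁ ∷ neg v₂ ∷ ors 2F , neg v₂ ∷ ors 2F) ∷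
    -- The antecedent ¬v₁ ∨ ¬v₂ ∨ x is a compensation clause of the third inference.
    (v₁ , neg v₂ ∷ ors 2F , neg v₂ ∷ ors 2F) ∷
    (v₂ , ors 2F , ors 2F) ∷ []

module LastCell where

  open Derivations (≡-dec (Fin._≟_ {3}) (Fin._≟_ {2}))
  open Cell 0

  -- At the right end of a row, t has x as its only successor, so nothing is handed on.
  derivation : ∀ b → premises b ⊢[ 9 ] [ ors 2F ]
  derivation false = to-witness-T (run (premises false) (inferences false) [ ors 2F ]) _
  derivation true  = to-witness-T (run (premises true) (inferences true) [ ors 2F ]) _

module HintedCell where

  open Derivations (≡-dec (Fin._≟_ {4}) (Fin._≟_ {2}))
  open Cell 1

  hintedPremises : Bool → ClauseMultiset
  hintedPremises b = premises b ++ [ ors 2F ++ ors 3F ]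

  conclusions : ClauseMultiset
  conclusions = ors 2F ∷ (ors 3F ++ ors 1F) ∷ []

  hintedInferences : Bool → List Inference
  hintedInferences b = inferences b ++
    -- The hint first loses x₂ against t ∨ x₁ ∨ ¬x₂; the x₁ that remains is then removed with t ∨
    -- ¬x₁.
    (x₂ , pos x₁ ∷ ors 3F , pos t₁ ∷ pos t₂ ∷ pos x₁ ∷ []) ∷
    (x₁ , ors 3F ++ ors 1F , ors 1F) ∷ []

  derivation : ∀ b → hintedPremises b ⊢[ 11 ] conclusions
  derivation false = to-witness-T (run (hintedPremises false) (hintedInferences false) conclusions) _
  derivation true  = to-witness-T (run (hintedPremises true) (hintedInferences true) conclusions) _

module Sink where

  open Derivations (≡-dec (Fin._≟_ {1}) (Fin._≟_ {2}))

  premises : ClauseMultiset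
  premises = (pos (0F , 0F) ∷ pos (0F , 1F) ∷ []) ∷ map (λ a → [ neg (0F , a) ]) (allFin 2)

  inferences : List Inference
  inferences = ((0F , 0F) , [ pos (0F , 1F) ] , []) ∷ ((0F , 1F) , [] , []) ∷ []

  derivation : premises ⊢[ 2 ] [ [] ]
  derivation = to-witness-T (run premises inferences [ [] ]) _

-- Placing concrete derivations at distinct vertices of a graph

module Embedding (G : PebblingDAG) {n} {vs : Vec (PebblingDAG.Vertex G) n} (vs! : VecUnique.Unique vs) where

  embed : Fin n × Fin 2 → Variable G
  embed (k , a) = Vec.lookup vs k , a

  embed-injective : Injective _≡_ _≡_ embed
  embed-injective {k , a} {l , b} eq with k≡l , refl ← ,-injective eq =
    cong (_, a) (VecUnique.lookup-injective vs! k l k≡l)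

  open Renaming (≡-dec (Fin._≟_ {n}) (Fin._≟_ {2})) (variable-≟ G) embed embed-injective public

-- Rows of the pyramid and the sibling pairs in them

adjacent : ∀ {A : Set} → List A → List (A × A)
adjacent (x ∷ y ∷ zs) = (x , y) ∷ adjacent (y ∷ zs)
adjacent _            = []

adjacent⊆unorderedPairs : ∀ {A : Set} (xs : List A) → adjacent xs ⊆ unorderedPairs xs
adjacent⊆unorderedPairs []           = []
adjacent⊆unorderedPairs (x ∷ [])     = []
adjacent⊆unorderedPairs (x ∷ y ∷ zs) =
  refl ∷ Sublist.++⁺ˡ (map (x ,_) zs) (adjacent⊆unorderedPairs (y ∷ zs))

unorderedPairs-++ : ∀ {A : Set} (xs : List A) {ys} →
  unorderedPairs xs ++ unorderedPairs ys ⊆ unorderedPairs (xs ++ ys)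
unorderedPairs-++ []            = ⊆-refl
unorderedPairs-++ (x ∷ xs) {ys} = ⊆-trans
  (⊆-reflexive (List.++-assoc (map (x ,_) xs) (unorderedPairs xs) (unorderedPairs ys)))
  (Sublist.++⁺ (Sublist.map⁺ (x ,_) (Sublist.++⁺ʳ ys ⊆-refl)) (unorderedPairs-++ xs))

module Rows (h : ℕ) where

  open PyramidVertex

  shift≤ : ∀ i j k → i + j + suc k ≤ h → i + suc j + k ≤ h
  shift≤ i j k = subst (_≤ h) (trans (ℕ.+-suc (i + j) k) (cong (_+ k) (sym (ℕ.+-suc i j))))

  below≤ : ∀ i j k → suc i + j + k ≤ h → i + suc j + k ≤ h
  below≤ i j k = subst (λ m → m + k ≤ h) (sym (ℕ.+-suc i j))

  above≤ : ∀ i k → i + 0 + suc k ≤ h → suc i + 0 + k ≤ h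
  above≤ i k = subst (_≤ h) (ℕ.+-suc (i + 0) k)

  mutual
    -- Separating `rowTail` makes `row` reduce to a cons for every `k`, which counts the vertices
    -- right of the first. The next neighbour is thus visible without a case distinction.
    row : ∀ i j k → .(i + j + k ≤ h) → List (V h)
    row i j k p = ⟨ i , j ⟩ {ℕ.m+n≤o⇒m≤o (i + j) p} ∷ rowTail i j k p

    rowTail : ∀ i j k → .(i + j + k ≤ h) → List (V h)
    rowTail i j zero    p = []
    rowTail i j (suc k) p = row i (suc j) k (shift≤ i j k p)

  -- Each row is one shorter than the row below, so a single `k` serves as number of rows and as
  -- length of the first; the lengths are `k`, ..., 1.
  rowsAbove : ∀ i k → .(i + 0 + k ≤ h) → List (V h)
  rowsAbove i zero    p = []
  rowsAbove i (suc k) p = row (suc i) 0 k (above≤ i k p) ++ rowsAbove (suc i) k (above≤ i k p)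

  -- For `i = 0` the list starts above the sources, which have no predecessors and hence no
  -- siblings.
  hintsAbove : ∀ i k → .(i + 0 + k ≤ h) → List (V h × V h)
  hintsAbove i zero    p = []
  hintsAbove i (suc k) p =
    adjacent (row (suc i) 0 k (above≤ i k p)) ++ hintsAbove (suc i) k (above≤ i k p)

  hintsAbove⊆ : ∀ i k .(p : i + 0 + k ≤ h) → hintsAbove i k p ⊆ unorderedPairs (rowsAbove i k p)
  hintsAbove⊆ i zero    p = []
  hintsAbove⊆ i (suc k) p = ⊆-trans
    (Sublist.++⁺ (adjacent⊆unorderedPairs (row (suc i) 0 k _)) (hintsAbove⊆ (suc i) k _))
    (unorderedPairs-++ (row (suc i) 0 k _))

  -- Vertices with equal coordinates are equal, the bound being irrelevant; so `f` is described by
  -- its coordinates, which the induction can shift.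
  tabulate-row : ∀ i j k .(p : i + j + k ≤ h) (f : Fin (suc k) → V h) →
    (∀ m → layer (f m) ≡ i) → (∀ m → position (f m) ≡ j + toℕ m) → tabulate f ≡ row i j k p
  tabulate-row i j zero    p f f-layer f-position =
    cong [_] (ext h (f-layer 0F) (trans (f-position 0F) (ℕ.+-identityʳ j)))
  tabulate-row i j (suc k) p f f-layer f-position = cong₂ _∷_
    (ext h (f-layer 0F) (trans (f-position 0F) (ℕ.+-identityʳ j)))
    (tabulate-row i (suc j) k (shift≤ i j k p) (f ∘ suc) (f-layer ∘ suc)
      (λ m → trans (f-position (suc m)) (ℕ.+-suc j (toℕ m))))

  layerVertices≡row : ∀ i l k .(p : l + 0 + k ≤ h) → l ≡ toℕ i → k ≡ h ∸ toℕ i →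
    layerVertices h i ≡ row l 0 k p
  layerVertices≡row i _ _ p refl refl = trans (List.map-tabulate id (vertex h i))
    (tabulate-row (toℕ i) 0 (h ∸ toℕ i) p (vertex h i) (λ _ → refl) (λ _ → refl))

  -- Layer and length of each `f m` enter through equations, which the induction adjusts without
  -- transporting vertices.
  concat-rows : ∀ i k .(p : i + 0 + k ≤ h) (f : Fin (suc k) → List (V h)) →
    (∀ m l n .(q : l + 0 + n ≤ h) → l ≡ i + toℕ m → n ≡ k ∸ toℕ m → f m ≡ row l 0 n q) →
    concat (tabulate f) ≡ row i 0 k p ++ rowsAbove i k p
  concat-rows i zero    p f f-row =
    cong (_++ []) (f-row 0F i 0 p (sym (ℕ.+-identityʳ i)) refl)
  concat-rows i (suc k) p f f-row = cong₂ _++_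
    (f-row 0F i (suc k) p (sym (ℕ.+-identityʳ i)) refl)
    (concat-rows (suc i) k (above≤ i k p) (f ∘ suc)
      λ m l n q l≡ n≡ → f-row (suc m) l n q (trans l≡ (sym (ℕ.+-suc i (toℕ m)))) n≡)

  vertices≡rows : pyramidVertices h ≡ row 0 0 h ℕ.≤-refl ++ rowsAbove 0 h ℕ.≤-refl
  vertices≡rows = trans (cong concat (List.map-tabulate id (layerVertices h)))
    (concat-rows 0 h ℕ.≤-refl (layerVertices h) (layerVertices≡row))

  length-row : ∀ i j k .(p : i + j + k ≤ h) → length (row i j k p) ≡ suc k
  length-row i j zero    p = refl
  length-row i j (suc k) p = cong suc (length-row i (suc j) k _)

  open PebblingDAG (Pyramid h) using (Siblings; _⇒*_)

  path-layer : ∀ {u v} → u ⇒* v → u ≡ v ⊎ layer u < layer v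
  path-layer ε = inj₁ refl
  path-layer (e ◅ es) with path-layer es
  ... | inj₁ refl = inj₂ (edgeLayer h e)
  ... | inj₂ <v   = inj₂ (ℕ.<-trans (edgeLayer h e) <v)

  -- Every edge raises the layer, so only the empty path stays within one.
  same-layer-unreachable : ∀ {u v} → layer u ≡ layer v → u ≢ v → ¬ u ⇒* v
  same-layer-unreachable eq u≢v path with path-layer path
  ... | inj₁ u≡v = u≢v u≡v
  ... | inj₂ u<v = ℕ.<-irrefl eq u<v

  adjacent-siblings : ∀ i j k .(p : suc i + j + k ≤ h) →
    All (λ (u , v) → Siblings u v) (adjacent (row (suc i) j k p))
  adjacent-siblings i j zero    p = []
  adjacent-siblings i j (suc k) p =
    ((same-layer-unreachable refl (λ eq → ℕ.1+n≢n (sym (cong position eq))) ,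
      same-layer-unreachable refl (λ eq → ℕ.1+n≢n (cong position eq))) ,
     -- The right predecessor of the left vertex is the left predecessor of the right vertex.
     (⟨ i , suc j ⟩ {ℕ.m+n≤o⇒m≤o (i + suc j) (below≤ i j (suc k) p)} , just (inj₂ refl) , just (inj₁ refl)))
    ∷ adjacent-siblings i (suc j) k _

  hintsAbove-siblings : ∀ i k .(p : i + 0 + k ≤ h) →
    All (λ (u , v) → Siblings u v) (hintsAbove i k p)
  hintsAbove-siblings i zero    p = []
  hintsAbove-siblings i (suc k) p =
    All.++⁺ (adjacent-siblings i 0 k _) (hintsAbove-siblings (suc i) k _)

-- Counts of steps and vertices

-- For a row of `k + 1` vertices: 9 inferences in its last cell and 11 in each hinted cell.
rowSteps : ℕ → ℕ
rowSteps zero    = 9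
rowSteps (suc k) = 11 + rowSteps k

rowsSteps : ℕ → ℕ
rowsSteps zero    = 0
rowsSteps (suc k) = rowSteps k + rowsSteps k

triangular : ℕ → ℕ
triangular zero    = 0
triangular (suc k) = suc k + triangular k

-- The refutation, row by row

module PyramidRefutation (h : ℕ) where

  open Rows h
  open PebblingDAG (Pyramid h) using (Siblings; siblings?)
  open Derivations (variable-≟ (Pyramid h))
  open CommutativeMonoidSolver ++-commutativeMonoid using (solve; _⊕_; _⊜_)

  ∨ : V h → Clause
  ∨ = or (Pyramid h)

  axioms : V h → ClauseMultiset
  axioms = pebbling (Pyramid h)

  hint : V h × V h → Clause
  hint (u , v) = ∨ u ++ ∨ v

  carry : Bool → V h → V h → Clause
  carry false x v = ∨ v
  carry true  x v = ∨ x ++ ∨ v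

  module CellAt i j .(p : suc i + j ≤ h) where

    v t x : V h
    v = ⟨ i , j ⟩ {ℕ.<⇒≤ p}
    t = ⟨ i , suc j ⟩ {subst (_≤ h) (sym (ℕ.+-suc i j)) p}
    x = ⟨ suc i , j ⟩ {p}

    lastCell : ∀ b → (carry b x v ∷ ∨ t ∷ axioms x) ⟹[ 9 ] [ ∨ x ]
    -- The renamed premises compute to the stated clauses only once `b` is fixed.
    lastCell = λ where
        false → ⊢-rename (LastCell.derivation false)
        true  → ⊢-rename (LastCell.derivation true)
      where
      distinct : VecUnique.Unique (v ∷ t ∷ x ∷ [])
      distinct = ((λ ()) ∷ (λ ()) ∷ []) ∷ ((λ ()) ∷ []) ∷ [] ∷ []
      open Embedding (Pyramid h) distinct

    module _ .(q : suc i + suc j ≤ h) where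

      y : V h
      y = ⟨ suc i , suc j ⟩ {q}

      hintedCell : ∀ b →
        (carry b x v ∷ ∨ t ∷ axioms x ++ [ hint (x , y) ]) ⟹[ 11 ] (∨ x ∷ carry true y t ∷ [])
      hintedCell = λ where
          false → ⊢-rename (HintedCell.derivation false)
          true  → ⊢-rename (HintedCell.derivation true)
        where
        distinct : VecUnique.Unique (v ∷ t ∷ x ∷ y ∷ [])
        distinct = ((λ ()) ∷ (λ ()) ∷ (λ ()) ∷ []) ∷ ((λ ()) ∷ (λ ()) ∷ []) ∷ ((λ ()) ∷ []) ∷ [] ∷ []
        open Embedding (Pyramid h) distinct

  -- Induction along the row. The row below has one vertex more; the clause of its leftmost
  -- remaining vertex v is replaced by the carry, and each hinted cell produces the carry of the
  -- next.
  deriveRow : ∀ b i j k .(p : suc i + j + k ≤ h) →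
    let x = ⟨ suc i , j ⟩ {ℕ.m+n≤o⇒m≤o (suc i + j) p}
        v = ⟨ i , j ⟩ {ℕ.<⇒≤ (ℕ.m+n≤o⇒m≤o (suc i + j) p)}
        xs = row (suc i) j k p in
    ((carry b x v ∷ map ∨ (row i (suc j) k (below≤ i j k p))) ++
     (concatMap axioms xs ++ map hint (adjacent xs)))
      ⟹[ rowSteps k ] map ∨ xs
  deriveRow b i j zero    p = CellAt.lastCell i j _ b
  deriveRow b i j (suc k) p = ⟹-focus {Γ = cell} (O ++ (P ++ H))
    (solve 6 (λ ct o q p x hs → (ct ⊕ o) ⊕ ((q ⊕ p) ⊕ (x ⊕ hs)) ⊜ (ct ⊕ (q ⊕ x)) ⊕ (o ⊕ (p ⊕ hs)))
       ↭-refl ct O Q P [ hint (x , y) ] H)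
    (CellAt.hintedCell i j _ _ b)
    -- The finished `∨ x` is set aside, and `carry true y t` becomes the first premise of the
    -- remaining row.
    (⟹-keep (∨ x) (deriveRow true i (suc j) k (shift≤ (suc i) j k p)))
    where
    x = ⟨ suc i , j ⟩ {ℕ.m+n≤o⇒m≤o (suc i + j) p}
    y = ⟨ suc i , suc j ⟩ {ℕ.m+n≤o⇒m≤o (suc i + suc j) (shift≤ (suc i) j k p)}
    v = ⟨ i , j ⟩ {ℕ.<⇒≤ (ℕ.m+n≤o⇒m≤o (suc i + j) p)}
    t = ⟨ i , suc j ⟩ {ℕ.m+n≤o⇒m≤o (i + suc j) (below≤ i j (suc k) p)}
    xs = row (suc i) (suc j) k (shift≤ (suc i) j k p)
    ct = carry b x v ∷ ∨ t ∷ []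
    Q = axioms x
    cell = ct ++ (Q ++ [ hint (x , y) ])
    O = map ∨ (row i (suc (suc j)) k (shift≤ i (suc j) k (below≤ i j (suc k) p)))
    P = concatMap axioms xs
    H = map hint (adjacent xs)

  deriveTop : ∀ i k .(p : i + 0 + k ≤ h) → i + k ≡ h →
    (map ∨ (row i 0 k p) ++
     (concatMap axioms (rowsAbove i k p) ++ map hint (hintsAbove i k p)))
      ⟹[ rowsSteps k ] [ ∨ (top h) ]
  deriveTop i zero    p i+k≡h =
    -- Here `i = h`, so the only vertex of the row is the sink.
    subst (λ z → [ ∨ z ] ⟹[ 0 ] [ ∨ (top h) ])
      (ext h (trans (sym i+k≡h) (ℕ.+-identityʳ i)) refl) ⟹-refl
  deriveTop i (suc k) p i+k≡h = ⟹-focus (P′ ++ H′)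
    (↭-trans
      (↭-reflexive (cong (O ++_) (cong₂ _++_
        (List.concatMap-++ axioms xs (rowsAbove (suc i) k (above≤ i k p)))
        (map-++ hint (adjacent xs) (hintsAbove (suc i) k (above≤ i k p))))))
      (solve 5 (λ o p p′ hs hs′ → o ⊕ ((p ⊕ p′) ⊕ (hs ⊕ hs′)) ⊜ (o ⊕ (p ⊕ hs)) ⊕ (p′ ⊕ hs′))
        ↭-refl O P P′ H H′))
    -- At the left end of a row no cell has spent `∨ v` yet.
    (deriveRow false i 0 k (above≤ i k p))
    (deriveTop (suc i) k (above≤ i k p) (trans (sym (ℕ.+-suc i k)) i+k≡h))
    where
    xs = row (suc i) 0 k (above≤ i k p)
    O = map ∨ (row i 0 (suc k) p)
    P = concatMap axioms xs
    P′ = concatMap axioms (rowsAbove (suc i) k (above≤ i k p))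
    H = map hint (adjacent xs)
    H′ = map hint (hintsAbove (suc i) k (above≤ i k p))

  refuteTop : (∨ (top h) ∷ map (λ a → [ neg (top h , a) ]) (allFin 2)) ⟹[ 2 ] [ [] ]
  refuteTop = ⊢-rename Sink.derivation
    where open Embedding (Pyramid h) {vs = top h ∷ []} ([] ∷ [])

  axioms-sources : ∀ j k .(p : j + k ≤ h) → concatMap axioms (row 0 j k p) ≡ map ∨ (row 0 j k p)
  axioms-sources j zero    p = refl
  axioms-sources j (suc k) p = cong (∨ (⟨ 0 , j ⟩ {ℕ.m+n≤o⇒m≤o j p}) ∷_) (axioms-sources (suc j) k _)

  -- `unorderedPairs` lists each pair in one orientation, that of the vertex list. As this list runs
  -- through each row from left to right, it agrees with `adjacent`.
  hints : ∃[ L ] map hint (filter (λ (u , v) → siblings? u v) (unorderedPairs (pyramidVertices h)))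
            ↭ map hint (hintsAbove 0 h ℕ.≤-refl) ++ L
  hints = ⊆⇒↭ (Sublist.map⁺ hint (⊆-trans
    (⊆-reflexive (sym (List.filter-all siblingPair? (hintsAbove-siblings 0 h ℕ.≤-refl))))
    (Sublist.filter⁺ siblingPair? siblingPair? (λ { refl → id })
      (⊆-trans (hintsAbove⊆ 0 h ℕ.≤-refl)
        (⊆-trans (Sublist.++⁺ˡ (unorderedPairs (row 0 0 h ℕ.≤-refl)) ⊆-refl)
          (⊆-trans (unorderedPairs-++ (row 0 0 h ℕ.≤-refl))
            (⊆-reflexive (cong unorderedPairs (sym vertices≡rows)))))))))
    where
    siblingPair? : (uv : V h × V h) → Dec (Siblings (proj₁ uv) (proj₂ uv))
    siblingPair? (u , v) = siblings? u v

  refutation : MaxResRefutation (Pyramid h) (rowsSteps h + 2)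
  refutation = ⟹-refutation (⟹-focus (N ++ L)
    (↭-trans (++⁺ (↭-reflexive pebbling≡) (++⁺ˡ N H↭))
      (solve 5 (λ o p n hs l → (o ⊕ p) ⊕ (n ⊕ (hs ⊕ l)) ⊜ (o ⊕ (p ⊕ hs)) ⊕ (n ⊕ l)) ↭-refl O P N H L))
    (deriveTop 0 h ℕ.≤-refl refl)
    -- Two more steps resolve the derived `∨ (top h)` with the two unit clauses of the sink.
    (⟹-weaken L ↭-refl refuteTop))
    where
    N = map (λ a → [ neg (top h , a) ]) (allFin 2)
    O = map ∨ (row 0 0 h ℕ.≤-refl)
    P = concatMap axioms (rowsAbove 0 h ℕ.≤-refl)
    H = map hint (hintsAbove 0 h ℕ.≤-refl)
    L = proj₁ hints
    H↭ = proj₂ hints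
    pebbling≡ : concatMap axioms (pyramidVertices h) ≡ O ++ P
    pebbling≡ = trans (cong (concatMap axioms) vertices≡rows)
      (trans (List.concatMap-++ axioms (row 0 0 h ℕ.≤-refl) (rowsAbove 0 h ℕ.≤-refl))
        (cong (_++ P) (axioms-sources 0 h ℕ.≤-refl)))

  length-rowsAbove : ∀ i k .(p : i + 0 + k ≤ h) → length (rowsAbove i k p) ≡ triangular k
  length-rowsAbove i zero    p = refl
  length-rowsAbove i (suc k) p = trans (List.length-++ (row (suc i) 0 k _))
    (cong₂ _+_ (length-row (suc i) 0 k _) (length-rowsAbove (suc i) k _))

  size≡ : PebblingDAG.size (Pyramid h) ≡ triangular (suc h)
  size≡ = trans (cong length vertices≡rows) (trans (List.length-++ (row 0 0 h ℕ.≤-refl))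
    (cong₂ _+_ (length-row 0 0 h ℕ.≤-refl) (length-rowsAbove 0 h ℕ.≤-refl)))

-- Growth of the number of vertices and of steps

size : ℕ → ℕ
size h = PebblingDAG.size (Pyramid h)

double-triangular : ∀ k → 2 * triangular k ≡ k * suc k
double-triangular zero    = refl
double-triangular (suc k) = trans (ℕ.*-distribˡ-+ 2 (suc k) (triangular k))
  (trans (cong (2 * suc k +_) (double-triangular k)) (eq k))
  where
  eq : ∀ k → 2 * suc k + k * suc k ≡ suc k * suc (suc k)
  eq = solve-∀

square≤size : ∀ h → h ^ 2 ≤ 2 * size h
square≤size h = begin
  h ^ 2                  ≡⟨ cong (h *_) (ℕ.*-identityʳ h) ⟩
  h * h                  ≤⟨ ℕ.*-mono-≤ (ℕ.n≤1+n h) (ℕ.m≤n+m h 2) ⟩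
  suc h * suc (suc h)    ≡⟨ double-triangular (suc h) ⟨
  2 * triangular (suc h) ≡⟨ cong (2 *_) (PyramidRefutation.size≡ h) ⟨
  2 * size h             ∎
  where open ℕ.≤-Reasoning

size≤square : ∀ h → 1 ≤ h → size h ≤ 6 * h ^ 2
size≤square h 1≤h = begin
  size h                 ≡⟨ PyramidRefutation.size≡ h ⟩
  triangular (suc h)     ≤⟨ ℕ.m≤m+n _ _ ⟩
  2 * triangular (suc h) ≡⟨ double-triangular (suc h) ⟩
  -- For `h ≥ 1` the factors are at most `2h` and `3h`, whence the constant 6.
  suc h * suc (suc h)    ≤⟨ ℕ.*-mono-≤ (ℕ.+-monoˡ-≤ h 1≤h) (ℕ.+-monoˡ-≤ h (ℕ.+-mono-≤ 1≤h 1≤h)) ⟩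
  (h + h) * (h + h + h)  ≡⟨ eq h ⟩
  6 * h ^ 2              ∎
  where
  open ℕ.≤-Reasoning
  eq : ∀ h → (h + h) * (h + h + h) ≡ 6 * (h * (h * 1))
  eq = solve-∀

2+k≤rowSteps : ∀ k → 2 + k ≤ rowSteps k
2+k≤rowSteps zero    = ℕ.m≤m+n 2 7
2+k≤rowSteps (suc k) = ℕ.+-mono-≤ (ℕ.m≤m+n 1 10) (2+k≤rowSteps k)

rowSteps≤ : ∀ k → rowSteps k ≤ 11 * suc k
rowSteps≤ zero    = ℕ.m≤m+n 9 2
rowSteps≤ (suc k) = ℕ.≤-trans (ℕ.+-monoʳ-≤ 11 (rowSteps≤ k)) (ℕ.≤-reflexive (sym (ℕ.*-suc 11 (suc k))))

-- The steps for a row of `k + 1` vertices pay for the row below it, which has `k + 2`; the two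
-- closing steps pay for the sink.
triangular≤rowsSteps : ∀ k → triangular (suc k) ≤ rowsSteps k + 2
triangular≤rowsSteps zero    = ℕ.m≤m+n 1 1
triangular≤rowsSteps (suc k) = ℕ.≤-trans
  (ℕ.+-mono-≤ (2+k≤rowSteps k) (triangular≤rowsSteps k))
  (ℕ.≤-reflexive (sym (ℕ.+-assoc (rowSteps k) (rowsSteps k) 2)))

rowsSteps≤triangular : ∀ k → rowsSteps k ≤ 11 * triangular k
rowsSteps≤triangular zero    = z≤n
rowsSteps≤triangular (suc k) = ℕ.≤-trans
  (ℕ.+-mono-≤ (rowSteps≤ k) (rowsSteps≤triangular k))
  (ℕ.≤-reflexive (sym (ℕ.*-distribˡ-+ 11 (suc k) (triangular k))))

size≤steps : ∀ h → size h ≤ 1 * (rowsSteps h + 2)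
size≤steps h = begin
  size h                ≡⟨ PyramidRefutation.size≡ h ⟩
  triangular (suc h)    ≤⟨ triangular≤rowsSteps h ⟩
  rowsSteps h + 2       ≡⟨ ℕ.*-identityˡ _ ⟨
  1 * (rowsSteps h + 2) ∎
  where open ℕ.≤-Reasoning

steps≤size : ∀ h → rowsSteps h + 2 ≤ 11 * size h
steps≤size h = begin
  rowsSteps h + 2                ≤⟨ ℕ.+-mono-≤ (rowsSteps≤triangular h) 2≤ ⟩
  11 * triangular h + 11 * suc h ≡⟨ ℕ.+-comm (11 * triangular h) (11 * suc h) ⟩
  11 * suc h + 11 * triangular h ≡⟨ ℕ.*-distribˡ-+ 11 (suc h) (triangular h) ⟨
  11 * triangular (suc h)        ≡⟨ cong (11 *_) (PyramidRefutation.size≡ h) ⟨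
  11 * size h                    ∎
  where
  open ℕ.≤-Reasoning
  -- The two closing steps are charged to the `h + 1` sources, which no row derivation has been
  -- charged to.
  2≤ : 2 ≤ 11 * suc h
  2≤ = ℕ.≤-trans (ℕ.m≤m+n 2 9) (ℕ.m≤m*n 11 (suc h))

lemma3p2 : let n = λ h → PebblingDAG.size (Pyramid h) in
    n ∈Θ (λ h → h ^ 2) ×
    (∃[ s ] (∀ (h : ℕ) → MaxResRefutation (Pyramid h) (s h)) × s ∈Θ n)
lemma3p2 =
  -- The threshold is 1 because at `h = 0` there is one vertex while `h ^ 2` vanishes.
  (2 , 6 , 1 , λ h 1≤h → square≤size h , size≤square h 1≤h) ,
  ((λ h → rowsSteps h + 2) , PyramidRefutation.refutation ,
   (1 , 11 , 0 , λ h _ → size≤steps h , steps≤size h))
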